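{- Let $n\ge 2$ and let $P$ be an $n\times n$ permutation matrix. Then $P$ is the leaf matrix of exactly one CNM of size $n$ if and only if (a) for every $k$ with $2\le k\le n-1$ the $k$-th L-subset of $P$ contains exactly one entry equal to $1$, and (b) $P$ has no entry equal to $1$ on its main diagonal.
   Context: A complete non-ambiguous matrix (CNM) of size $n$ is an $n\times n$ matrix $M=(m_{i,j})$ with entries in $\{0,1\}$ whose support $T=\{(i,j): m_{i,j}=1\}$ (whose elements are called vertices) satisfies: (1) $(1,1)\in T$; (2) for every $p=(i,j)\in T$ with $p\neq(1,1)$, exactly one of the following holds: there is $(i',j)\in T$ with $i'<i$, or there is $(i,j')\in T$ with $j'<j$; (3) every row and every column of $M$ contains at least one vertex; (4) define the parent of $p=(i,j)\neq(1,1)$ to be $(i',j)$ with $i'<i$ maximal if such a vertex exists, and otherwise $(i,j')$ with $j'<j$ maximal; then every vertex is the parent of either zero or exactly two vertices. A vertex with no children is a leaf. The leaf matrix $p(M)$ is obtained from $M$ by replacing all non-leaf vertices by $0$ (it is a permutation matrix). For an $n\times n$ matrix and $k>1$, the $k$-th L-subset is the set of positions $\{(i,j): (i=k \text{ and } j\le k) \text{ or } (j=k \text{ and } i\le k)\}$. -}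

module Defs where

open import Data.Bool.Base using (Bool; true; false; if_then_else_)
import Data.Bool.Properties as Bool
open import Data.Fin.Base using (Fin; toℕ; _<_; _≤_)
open import Data.Fin.Properties using (_≟_; _<?_; _≤?_; any?; all?)
import Data.Nat.Properties as ℕ
import Data.Nat.Base as ℕ
open import Data.Nat.Base using (ℕ; suc)
open import Data.Product using (_×_; _,_; ∃; ∃!; ∃-syntax)
open import Data.Sum.Base using (_⊎_)
open import Relation.Binary.PropositionalEquality.Core using (_≡_; _≢_)
open import Relation.Nullary.Decidable.Core using (Dec; does; ¬?; _×-dec_; _⊎-dec_; _→-dec_)
open import Relation.Nullary.Negation.Core using (¬_)
open import Relation.Unary using (Pred; Decidable)
open import Level using (0ℓ)

-- Entries in {0,1}: false is 0 and true is 1.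
Matrix : ℕ → Set
Matrix n = Fin n → Fin n → Bool

infix 4 _≐_
_≐_ : ∀ {n} → Matrix n → Matrix n → Set
M ≐ N = ∀ i j → M i j ≡ N i j

Position : ℕ → Set
Position n = Fin n × Fin n

index : ∀ {n} → Fin n → ℕ
index i = suc (toℕ i)

IsRoot : ∀ {n} → Position n → Set
IsRoot (i , j) = index i ≡ 1 × index j ≡ 1

Vertex : ∀ {n} → Matrix n → Position n → Set
Vertex M (i , j) = M i j ≡ true

Above : ∀ {n} → Matrix n → Position n → Pred (Fin n) 0ℓ
Above M (i , j) i′ = i′ < i × Vertex M (i′ , j)

LeftOf : ∀ {n} → Matrix n → Position n → Pred (Fin n) 0ℓ
LeftOf M (i , j) j′ = j′ < j × Vertex M (i , j′)

Greatest : ∀ {n} → Pred (Fin n) 0ℓ → Pred (Fin n) 0ℓ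
Greatest Q x = Q x × (∀ y → Q y → y ≤ x)

-- ParentOf M p q : the parent of the vertex p is q.
ParentOf : ∀ {n} → Matrix n → Position n → Position n → Set
ParentOf M p@(i , j) (i′ , j′) =
  Vertex M p × ¬ IsRoot p ×
  ( (Greatest (Above M p) i′ × j′ ≡ j)
  ⊎ (¬ ∃ (Above M p) × i′ ≡ i × Greatest (LeftOf M p) j′))

NoChildren : ∀ {n} → Matrix n → Position n → Set
NoChildren M q = ∀ i j → ¬ ParentOf M (i , j) q

TwoChildren : ∀ {n} → Matrix n → Position n → Set
TwoChildren M q =
  ∃[ p₁ ] ∃[ p₂ ] p₁ ≢ p₂ × ParentOf M p₁ q × ParentOf M p₂ q ×
    (∀ p → ParentOf M p q → p ≡ p₁ ⊎ p ≡ p₂)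

Leaf : ∀ {n} → Matrix n → Position n → Set
Leaf M p = Vertex M p × NoChildren M p

ExactlyOneOf : Set → Set → Set
ExactlyOneOf A B = (A × ¬ B) ⊎ (¬ A × B)

record IsCNM {n : ℕ} (M : Matrix n) : Set where
  field
    root        : ∃[ p ] IsRoot p × Vertex M p
    unambiguous : ∀ p → Vertex M p → ¬ IsRoot p →
                  ExactlyOneOf (∃ (Above M p)) (∃ (LeftOf M p))
    rows        : ∀ i → ∃[ j ] Vertex M (i , j)
    columns     : ∀ j → ∃[ i ] Vertex M (i , j)
    complete    : ∀ p → Vertex M p → NoChildren M p ⊎ TwoChildren M p

isRoot? : ∀ {n} (p : Position n) → Dec (IsRoot p)
isRoot? (i , j) = (index i ℕ.≟ 1) ×-dec (index j ℕ.≟ 1)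

vertex? : ∀ {n} (M : Matrix n) → Decidable (Vertex M)
vertex? M (i , j) = M i j Bool.≟ true

above? : ∀ {n} (M : Matrix n) p → Decidable (Above M p)
above? M (i , j) i′ = (i′ <? i) ×-dec vertex? M (i′ , j)

leftOf? : ∀ {n} (M : Matrix n) p → Decidable (LeftOf M p)
leftOf? M (i , j) j′ = (j′ <? j) ×-dec vertex? M (i , j′)

greatest? : ∀ {n} {Q : Pred (Fin n) 0ℓ} → Decidable Q → Decidable (Greatest Q)
greatest? Q? x = Q? x ×-dec all? (λ y → Q? y →-dec (y ≤? x))

parentOf? : ∀ {n} (M : Matrix n) p q → Dec (ParentOf M p q)
parentOf? M p@(i , j) (i′ , j′) =
  vertex? M p ×-dec ¬? (isRoot? p) ×-dec
  ( (greatest? (above? M p) i′ ×-dec (j′ ≟ j))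
  ⊎-dec (¬? (any? (above? M p)) ×-dec (i′ ≟ i) ×-dec greatest? (leftOf? M p) j′))

leaf? : ∀ {n} (M : Matrix n) → Decidable (Leaf M)
leaf? M q = vertex? M q ×-dec all? (λ i → all? (λ j → ¬? (parentOf? M (i , j) q)))

leafMatrix : ∀ {n} → Matrix n → Matrix n
leafMatrix M i j = if does (leaf? M (i , j)) then M i j else false

record IsPermutationMatrix {n : ℕ} (P : Matrix n) : Set where
  field
    row    : ∀ i → ∃! _≡_ (λ j → P i j ≡ true)
    column : ∀ j → ∃! _≡_ (λ i → P i j ≡ true)

LSubset : ∀ {n} → ℕ → Pred (Position n) 0ℓ
LSubset k (i , j) = (index i ≡ k × index j ℕ.≤ k) ⊎ (index j ≡ k × index i ℕ.≤ k)

{-# OPTIONS --safe #-}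
module Submission where

-- A CNM with leaf permutation π is a set of vertices (i , j) with j ≤ π i and
-- i ≤ π⁻¹ j, containing the root and the leaves, in which every non-root vertex
-- has a vertex either above it or on its left but not both.  In these terms:
--
-- * (a) and (b) say that π has no fixed point and that every interior k satisfies
--   π k < k < π⁻¹ k or π⁻¹ k < k < π k; hence for each 0 < k < n exactly one u
--   has u < k ≤ π u, and likewise for π⁻¹.  The set of all admissible positions
--   is then already unambiguous, and a CNM contained in another one equals it.
--
-- * Conversely, a greedy CNM takes the leftmost admissible position of each row,
--   and lets the first vertex of each column j be any admissible (i , j) with an
--   admissible position on its left, or the leaf of the column when it qualifies.
--   If the CNM is unique, it agrees with all greedy ones and with their
--   transposes.  By induction on k, the crossings u < k ≤ π u and e < k ≤ π⁻¹ e
--   are unique: π k ≥ k and π⁻¹ k ≥ k would produce a vertex with both a vertex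
--   above it and one on its left, while π k < k and π⁻¹ k < k would split the CNM
--   into two diagonal blocks.

open import Data.Bool.Base using (true; false)
open import Data.Nat.Base using (ℕ; _≤_; _∸_)
open import Data.Product using (_×_; _,_; ∃!)
open import Function.Bundles using (_⇔_)
open import Relation.Binary.PropositionalEquality.Core using (_≡_)
open import Defs

open import Data.Bool.Base using (Bool; if_then_else_)
open import Data.Bool.Properties using (⇔→≡; ¬-not)
open import Data.Fin.Base using (Fin; toℕ; fromℕ<) renaming (zero to fzero; _<_ to _<ᶠ_; _≤_ to _≤ᶠ_)
open import Data.Fin.Induction using (<-wellFounded)
open import Data.Fin.Permutation using (Permutation′; permutation; _⟨$⟩ʳ_; _⟨$⟩ˡ_; inverseˡ; inverseʳ; flip)
open import Data.Fin.Properties using (toℕ-injective; toℕ-fromℕ<; toℕ<n; <-cmp; any?; all?; _≟_; _<?_; _≤?_)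
open import Data.Nat.Base as ℕ using (zero; suc; z≤n; s≤s; _<_)
import Data.Nat.Properties as ℕ
open import Data.Product using (∃; ∃-syntax; proj₁; proj₂; swap; map₂)
open import Data.Sum.Base as Sum using (_⊎_; inj₁; inj₂)
open import Data.Vec.Functional using (updateAt)
open import Data.Vec.Functional.Properties using (updateAt-updates; updateAt-minimal)
open import Function.Base using (_∘_; const; case_of_)
open import Function.Bundles using (mk⇔; Equivalence)
open import Function.Construct.Composition using (_⇔-∘_)
open import Induction.WellFounded using (Acc; acc)
open import Level using (0ℓ)
open import Relation.Binary.Definitions using (tri<; tri≈; tri>)
open import Relation.Binary.PropositionalEquality.Core using (_≢_; refl; sym; trans; cong; subst)
open import Relation.Nullary using (Dec; yes; no; does; ¬_; contradiction)
open import Relation.Nullary.Decidable using (dec-true; _×-dec_; _⊎-dec_; _→-dec_)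
open import Relation.Nullary.Decidable.Core using (_because_)
open import Relation.Nullary.Reflects using (invert)
open import Relation.Unary using (Pred; Decidable)

private
  variable
    n : ℕ

-- Decisions, least elements and first vertices

holds : ∀ {A : Set} (a? : Dec A) → does a? ≡ true → A
holds (true because [a]) refl = invert [a]

does-if : ∀ {A : Set} {b} (a? : Dec A) → (if does a? then b else false) ≡ true ⇔ (A × b ≡ true)
does-if (yes a) = mk⇔ (a ,_) proj₂
does-if (no ¬a) = mk⇔ (λ ()) (λ (a , _) → contradiction a ¬a)

least : {Q : Pred (Fin n) 0ℓ} → Decidable Q → ∃ Q → ∃[ x ] Q x × (∀ y → Q y → x ≤ᶠ y)
least {Q = Q} Q? (x , q) = go x q (<-wellFounded x)
  where
  go : ∀ x → Q x → Acc _<ᶠ_ x → ∃[ x ] Q x × (∀ y → Q y → x ≤ᶠ y)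
  go x q (acc rs) with any? (λ y → (y <? x) ×-dec Q? y)
  ... | yes (y , y<x , qy) = go y qy (rs y<x)
  ... | no none = x , q , λ y qy → ℕ.≮⇒≥ (λ y<x → none (y , y<x , qy))

first∈row : ∀ {M : Matrix n} i → ∃[ j ] Vertex M (i , j) →
            ∃[ j ] Vertex M (i , j) × ¬ ∃ (LeftOf M (i , j))
first∈row {M = M} i v with least (λ j → vertex? M (i , j)) v
... | j , vj , min = j , vj , λ (j′ , j′<j , v′) → ℕ.<⇒≱ j′<j (min j′ v′)

first∈column : ∀ {M : Matrix n} j → ∃[ i ] Vertex M (i , j) →
               ∃[ i ] Vertex M (i , j) × ¬ ∃ (Above M (i , j))
first∈column {M = M} j v with least (λ i → vertex? M (i , j)) v
... | i , vi , min = i , vi , λ (i′ , i′<i , v′) → ℕ.<⇒≱ i′<i (min i′ v′)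

<⇒¬rootᵣ : ∀ {i′ i j : Fin n} → i′ <ᶠ i → ¬ IsRoot (i , j)
<⇒¬rootᵣ i′<i (i≡0 , _) = ℕ.n≮0 (subst (_ <_) (ℕ.suc-injective i≡0) i′<i)

<⇒¬rootᶜ : ∀ {j′ i j : Fin n} → j′ <ᶠ j → ¬ IsRoot (i , j)
<⇒¬rootᶜ j′<j (_ , j≡0) = ℕ.n≮0 (subst (_ <_) (ℕ.suc-injective j≡0) j′<j)

root-unique : ∀ {p q : Position n} → IsRoot p → IsRoot q → p ≡ q
root-unique (a , b) (c , d)
  with refl ← toℕ-injective (ℕ.suc-injective (trans a (sym c)))
     | refl ← toℕ-injective (ℕ.suc-injective (trans b (sym d))) = refl

-- Fillings and CNMs

Unambiguous : Matrix n → Set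
Unambiguous M = ∀ p → Vertex M p → ¬ IsRoot p → ExactlyOneOf (∃ (Above M p)) (∃ (LeftOf M p))

-- The CNMs with leaf matrix π, described without reference to parents and leaves.
record Filling (π : Permutation′ n) (M : Matrix n) : Set where
  field
    root        : ∃[ p ] IsRoot p × Vertex M p
    leaves      : ∀ i → Vertex M (i , π ⟨$⟩ʳ i)
    bounded     : ∀ i j → Vertex M (i , j) → j ≤ᶠ π ⟨$⟩ʳ i × i ≤ᶠ π ⟨$⟩ˡ j
    unambiguous : Unambiguous M

  leavesᶜ : ∀ j → Vertex M (π ⟨$⟩ˡ j , j)
  leavesᶜ j = subst (λ x → Vertex M (π ⟨$⟩ˡ j , x)) (inverseʳ π) (leaves (π ⟨$⟩ˡ j))

left⇒¬above : ∀ {M : Matrix n} → Unambiguous M → ∀ {i j} → Vertex M (i , j) →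
              ∃ (LeftOf M (i , j)) → ¬ ∃ (Above M (i , j))
left⇒¬above unamb v l@(_ , j′<j , _) with unamb _ v (<⇒¬rootᶜ j′<j)
... | inj₁ (_ , ¬l) = contradiction l ¬l
... | inj₂ (¬a , _) = ¬a

¬left⇒above : ∀ {M : Matrix n} → Unambiguous M → ∀ {i j} → Vertex M (i , j) → ¬ IsRoot (i , j) →
              ¬ ∃ (LeftOf M (i , j)) → ∃ (Above M (i , j))
¬left⇒above unamb v ¬r ¬l with unamb _ v ¬r
... | inj₁ (a , _) = a
... | inj₂ (_ , l) = contradiction l ¬l

¬above⇒left : ∀ {M : Matrix n} → Unambiguous M → ∀ {i j} → Vertex M (i , j) → ¬ IsRoot (i , j) →
              ¬ ∃ (Above M (i , j)) → ∃ (LeftOf M (i , j))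
¬above⇒left unamb v ¬r ¬a with unamb _ v ¬r
... | inj₁ (a , _) = contradiction a ¬a
... | inj₂ (_ , l) = l

_ᵀ : Matrix n → Matrix n
(M ᵀ) i j = M j i

-- Transposing exchanges π with its inverse, so arguments about what lies above also serve for what
-- lies on the left.
Filling-ᵀ : ∀ {π : Permutation′ n} {M} → Filling π M → Filling (flip π) (M ᵀ)
Filling-ᵀ f = record
  { root        = let ((i , j) , r , v) = root in (j , i) , swap r , v
  ; leaves      = leavesᶜ
  ; bounded     = λ i j v → swap (bounded j i v)
  ; unambiguous = λ (i , j) v ¬r → Sum.swap (Sum.map swap swap (unambiguous (j , i) v (¬r ∘ swap)))
  }
  where open Filling f

-- The nearest vertex on the right has a vertex on its left, hence none above, so its parent is
-- sought in its row and is (i , j).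
rightChild : ∀ {M : Matrix n} → Unambiguous M → ∀ {i j b} → Vertex M (i , j) →
             j <ᶠ b → Vertex M (i , b) → ∃[ b ] j <ᶠ b × ParentOf M (i , b) (i , j)
rightChild {M = M} unamb {i} {j} v j<b vb
  with least (λ b → (j <? b) ×-dec vertex? M (i , b)) (_ , j<b , vb)
... | b , (j<b , vb) , min =
  b , j<b , vb , <⇒¬rootᶜ j<b , inj₂ (left⇒¬above {M = M} unamb vb (j , j<b , v) , refl ,
    (j<b , v) , λ y (y<b , vy) → ℕ.≮⇒≥ (λ j<y → ℕ.<⇒≱ y<b (min y (j<y , vy))))

lowerChild : ∀ {M : Matrix n} {i j a} → Vertex M (i , j) →
             i <ᶠ a → Vertex M (a , j) → ∃[ a ] i <ᶠ a × ParentOf M (a , j) (i , j)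
lowerChild {M = M} {i} {j} v i<a va
  with least (λ a → (i <? a) ×-dec vertex? M (a , j)) (_ , i<a , va)
... | a , (i<a , va) , min =
  a , i<a , va , <⇒¬rootᵣ i<a , inj₁ (((i<a , v) ,
    λ y (y<a , vy) → ℕ.≮⇒≥ (λ i<y → ℕ.<⇒≱ y<a (min y (i<y , vy)))) , refl)

-- Otherwise the smaller of y and z would come between x and the larger. This limits a vertex to one
-- child in its row and one in its column.
Greatest-<-unique : ∀ {Q : Pred (Fin n) 0ℓ} {x y z} →
                    Greatest (λ w → w <ᶠ y × Q w) x → Greatest (λ w → w <ᶠ z × Q w) x →
                    Q y → Q z → y ≡ z
Greatest-<-unique {y = y} {z} ((x<y , _) , maxy) ((x<z , _) , maxz) qy qz with <-cmp y z
... | tri< y<z _ _ = contradiction (maxz y (y<z , qy)) (ℕ.<⇒≱ x<y)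
... | tri≈ _ y≡z _ = y≡z
... | tri> _ _ z<y = contradiction (maxy z (z<y , qz)) (ℕ.<⇒≱ x<z)

_≗ᵖ_ : Matrix n → Permutation′ n → Set
P ≗ᵖ π = ∀ i j → Vertex P (i , j) ⇔ π ⟨$⟩ʳ i ≡ j

module _ {π : Permutation′ n} {P : Matrix n} (P≗π : P ≗ᵖ π) where

  -- Nothing lies to the right of or below a position of π, so it is childless. Any other vertex
  -- comes strictly before the leaf of its row and the leaf of its column, which gives one child in
  -- each direction.
  filling⇒CNM : ∀ {M} → Filling π M → IsCNM M × leafMatrix M ≐ P
  filling⇒CNM {M} f = cnm , λ i j → ⇔→≡ {z = true} (mk⇔
      (λ l → Equivalence.from (P≗π i j) (leaf⇒≡ (proj₁ (Equivalence.to (does-if (leaf? M (i , j))) l))))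
      (λ p → Equivalence.from (does-if (leaf? M (i , j)))
        (let l = ≡⇒leaf (Equivalence.to (P≗π i j) p) in l , proj₁ l)))
    where
    open Filling f

    childless : ∀ i → NoChildren M (i , π ⟨$⟩ʳ i)
    childless i a b (v , _ , inj₁ (((i<a , _) , _) , refl)) =
      ℕ.<⇒≱ i<a (subst (a ≤ᶠ_) (inverseˡ π) (proj₂ (bounded a b v)))
    childless i a b (v , _ , inj₂ (_ , refl , (πi<b , _) , _)) =
      ℕ.<⇒≱ πi<b (proj₁ (bounded a b v))

    ≡⇒leaf : ∀ {i j} → π ⟨$⟩ʳ i ≡ j → Leaf M (i , j)
    ≡⇒leaf {i} refl = leaves i , childless i

    twoChildren : ∀ {i j} → Vertex M (i , j) → π ⟨$⟩ʳ i ≢ j → TwoChildren M (i , j)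
    twoChildren {i} {j} v πi≢j
      with rightChild {M = M} unambiguous v
             (ℕ.≤∧≢⇒< (proj₁ (bounded i j v)) (πi≢j ∘ sym ∘ toℕ-injective)) (leaves i)
         | lowerChild {M = M} v
             (ℕ.≤∧≢⇒< (proj₂ (bounded i j v))
               (λ i≡ρj → πi≢j (trans (cong (π ⟨$⟩ʳ_) (toℕ-injective i≡ρj)) (inverseʳ π)))) (leavesᶜ j)
    ... | b , _ , vb , ¬rb , inj₁ (((i<i , _) , _) , _) | _ = contradiction i<i (ℕ.<-irrefl refl)
    ... | _ | a , _ , va , ¬ra , inj₂ (_ , _ , (j<j , _) , _) = contradiction j<j (ℕ.<-irrefl refl)
    ... | b , j<b , pb@(vb , ¬rb , inj₂ (_ , _ , gb)) | a , i<a , pa@(va , ¬ra , inj₁ (ga , _)) =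
      (i , b) , (a , j) , (λ { refl → ℕ.<-irrefl refl i<a }) , pb , pa , λ where
        (a′ , b′) (v′ , _ , inj₁ (g , refl)) →
          inj₂ (cong (_, b′) (Greatest-<-unique g ga v′ va))
        (a′ , b′) (v′ , _ , inj₂ (_ , refl , g)) →
          inj₁ (cong (a′ ,_) (Greatest-<-unique g gb v′ vb))

    leaf⇒≡ : ∀ {i j} → Leaf M (i , j) → π ⟨$⟩ʳ i ≡ j
    leaf⇒≡ {i} {j} (v , none) with π ⟨$⟩ʳ i ≟ j
    ... | yes eq = eq
    ... | no neq with _ , _ , _ , p , _ ← twoChildren v neq = contradiction p (none _ _)

    cnm : IsCNM M
    cnm = record
      { root        = root
      ; unambiguous = unambiguous
      ; rows        = λ i → _ , leaves i
      ; columns     = λ j → _ , leavesᶜ j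
      ; complete    = λ (i , j) v → case π ⟨$⟩ʳ i ≟ j of λ where
          (yes eq) → inj₁ (proj₂ (≡⇒leaf eq))
          (no neq) → inj₂ (twoChildren v neq)
      }

  -- A vertex beyond the leaf of its row or column would provide that leaf with a child.
  CNM⇒filling : ∀ {M} → IsCNM M → leafMatrix M ≐ P → Filling π M
  CNM⇒filling {M} cnm lM≐P = record
    { root        = root
    ; leaves      = proj₁ ∘ leaf
    ; bounded     = λ i j v →
        ℕ.≮⇒≥ (λ πi<j →
          let _ , _ , child = rightChild {M = M} unambiguous (proj₁ (leaf i)) πi<j v
          in proj₂ (leaf i) _ _ child)
      , ℕ.≮⇒≥ (λ ρj<i →
          let _ , _ , child = lowerChild {M = M} (proj₁ (leafᶜ j)) ρj<i v
          in proj₂ (leafᶜ j) _ _ child)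
    ; unambiguous = unambiguous
    }
    where
    open IsCNM cnm

    leaf : ∀ i → Leaf M (i , π ⟨$⟩ʳ i)
    leaf i = proj₁ (Equivalence.to (does-if (leaf? M (i , π ⟨$⟩ʳ i)))
      (trans (lM≐P _ _) (Equivalence.from (P≗π _ _) refl)))

    leafᶜ : ∀ j → Leaf M (π ⟨$⟩ˡ j , j)
    leafᶜ j = subst (λ x → Leaf M (π ⟨$⟩ˡ j , x)) (inverseʳ π) (leaf (π ⟨$⟩ˡ j))

-- Both fillings have their first vertex of row i at the same place, because the
-- one of N has a vertex of M above it and so no vertex of M on its left.
above-∈ : ∀ {π : Permutation′ n} {M N} → Filling π M → Filling π N →
          (∀ i j → Vertex N (i , j) → Vertex M (i , j)) →
          ∀ i j → Vertex M (i , j) → ∃ (Above M (i , j)) → Vertex N (i , j)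
above-∈ {M = M} {N} fM fN N⊆M i j v a@(_ , i′<i , _)
  with first∈row {M = N} i (_ , leaves fN i)
  where open Filling
... | b , vb , ¬l with ¬left⇒above {M = N} (Filling.unambiguous fN) vb (<⇒¬rootᵣ i′<i) ¬l | <-cmp j b
... | i″ , i″<i , v″ | tri< j<b _ _ =
  contradiction (i″ , i″<i , N⊆M _ _ v″)
    (left⇒¬above {M = M} (Filling.unambiguous fM) (N⊆M i b vb) (j , j<b , v))
... | _ | tri≈ _ refl _ = vb
... | _ | tri> _ _ b<j =
  contradiction a (left⇒¬above {M = M} (Filling.unambiguous fM) v (b , b<j , N⊆M i b vb))

⊆⇒≐ : ∀ {π : Permutation′ n} {M N} → Filling π M → Filling π N →
      (∀ i j → Vertex N (i , j) → Vertex M (i , j)) → M ≐ N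
⊆⇒≐ {M = M} {N} fM fN N⊆M i j = ⇔→≡ {z = true} (mk⇔ M⊆N (N⊆M i j))
  where
  M⊆N : Vertex M (i , j) → Vertex N (i , j)
  M⊆N v with isRoot? (i , j)
  ... | yes r with p , rp , vp ← Filling.root fN with refl ← root-unique rp r = vp
  ... | no ¬r with Filling.unambiguous fM (i , j) v ¬r
  ...   | inj₁ (a , _) = above-∈ fM fN N⊆M i j v a
  ...   | inj₂ (_ , l) = above-∈ (Filling-ᵀ fM) (Filling-ᵀ fN) (λ a b → N⊆M b a) j i v l

-- Crossings of a permutation

Crosses : Permutation′ n → ℕ → Fin n → Set
Crosses π k u = toℕ u < k × k ≤ toℕ (π ⟨$⟩ʳ u)

Monotone : Permutation′ n → Fin n → Set
Monotone π k = (π ⟨$⟩ʳ k <ᶠ k × k <ᶠ π ⟨$⟩ˡ k) ⊎ (π ⟨$⟩ˡ k <ᶠ k × k <ᶠ π ⟨$⟩ʳ k)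

ʳ⇒ˡ : ∀ (π : Permutation′ n) {i j} → π ⟨$⟩ʳ i ≡ j → π ⟨$⟩ˡ j ≡ i
ʳ⇒ˡ π refl = inverseˡ π

crosses-from : ∀ (π : Permutation′ n) k → π ⟨$⟩ˡ k <ᶠ k → Crosses π (toℕ k) (π ⟨$⟩ˡ k)
crosses-from π k ρk<k = ρk<k , ℕ.≤-reflexive (cong toℕ (sym (inverseʳ π)))

-- Here π⁻¹ k is the unique crossing at k. It lands on k itself, so it does not reach k + 1 and only
-- k is left.
crossing-absorbed : ∀ (π : Permutation′ n) k → ∃! _≡_ (Crosses π (toℕ k)) → π ⟨$⟩ˡ k <ᶠ k →
                    ∀ v → Crosses π (suc (toℕ k)) v → v ≡ k
crossing-absorbed π k (u , _ , uniq) ρk<k v (v<1+k , k<πv) with v ≟ k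
... | yes v≡k = v≡k
... | no v≢k = contradiction k<πv (ℕ.<-irrefl (cong toℕ (sym πv≡k)))
  where
  v≡ρk : v ≡ π ⟨$⟩ˡ k
  v≡ρk = trans (sym (uniq (ℕ.≤∧≢⇒< (ℕ.s≤s⁻¹ v<1+k) (v≢k ∘ toℕ-injective) , ℕ.<⇒≤ k<πv)))
               (uniq (crosses-from π k ρk<k))

  πv≡k : π ⟨$⟩ʳ v ≡ k
  πv≡k = trans (cong (π ⟨$⟩ʳ_) v≡ρk) (inverseʳ π)

-- From k to k + 1 only π⁻¹ k can cease to cross and only k can begin to. At a descent through k
-- neither happens; at an ascent k takes the place of π⁻¹ k.
crossing-step : ∀ (π : Permutation′ n) k → Monotone π k →
                ∃! _≡_ (Crosses π (toℕ k)) → ∃! _≡_ (Crosses π (suc (toℕ k)))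
crossing-step π k (inj₁ (πk<k , k<ρk)) (u , (u<k , k≤πu) , uniq) =
  u , (ℕ.m<n⇒m<1+n u<k , ℕ.≤∧≢⇒< k≤πu k≢πu) , λ {v} (v<1+k , k<πv) →
    uniq (ℕ.≤∧≢⇒< (ℕ.s≤s⁻¹ v<1+k)
           (λ v≡k → ℕ.<-asym πk<k (subst (λ x → k <ᶠ π ⟨$⟩ʳ x) (toℕ-injective v≡k) k<πv))
         , ℕ.<⇒≤ k<πv)
  where
  k≢πu : toℕ k ≢ toℕ (π ⟨$⟩ʳ u)
  k≢πu eq = ℕ.<-asym u<k (subst (k <ᶠ_) (ʳ⇒ˡ π (sym (toℕ-injective eq))) k<ρk)
crossing-step π k (inj₂ (ρk<k , k<πk)) cr =
  k , (ℕ.≤-refl , k<πk) , λ {v} c → sym (crossing-absorbed π k cr ρk<k v c)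

crossing-base : ∀ (π : Permutation′ (suc n)) → π ⟨$⟩ʳ fzero ≢ fzero → ∃! _≡_ (Crosses π 1)
crossing-base π π0≢0 =
  fzero , (ℕ.≤-refl , ℕ.n≢0⇒n>0 (π0≢0 ∘ toℕ-injective)) ,
  λ (v<1 , _) → toℕ-injective (sym (ℕ.n<1⇒n≡0 v<1))

-- For n ≥ 2 such a π is a single cycle that rises from 0 to n - 1 and falls back to 0.
record Unimodal (π : Permutation′ n) : Set where
  field
    fixedPointFree : ∀ i → π ⟨$⟩ʳ i ≢ i
    monotone       : ∀ k → 0 < toℕ k → suc (toℕ k) < n → Monotone π k

Unimodal-flip : ∀ {π : Permutation′ n} → Unimodal π → Unimodal (flip π)
Unimodal-flip {π = π} u = record
  { fixedPointFree = λ i ρi≡i → fixedPointFree i (ʳ⇒ˡ (flip π) ρi≡i)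
  ; monotone       = λ k k>0 k<n → Sum.swap (monotone k k>0 k<n)
  }
  where open Unimodal u

interior-induction : ∀ (Q : ℕ → Set) → Q 1 →
                     (∀ (i : Fin n) → 0 < toℕ i → suc (toℕ i) < n → Q (toℕ i) → Q (suc (toℕ i))) →
                     ∀ k → 0 < k → k < n → Q k
interior-induction Q base step 1 _ _ = base
interior-induction {n} Q base step (suc k@(suc _)) _ 1+k<n =
  at (toℕ-fromℕ< k<n) (interior-induction Q base step k ℕ.z<s k<n)
  where
  k<n : k < n
  k<n = ℕ.<-trans ℕ.≤-refl 1+k<n

  at : ∀ {m} → toℕ (fromℕ< k<n) ≡ m → Q m → Q (suc m)
  at refl = step (fromℕ< k<n) (subst (0 <_) (sym (toℕ-fromℕ< k<n)) ℕ.z<s)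
    (subst (λ x → suc x < n) (sym (toℕ-fromℕ< k<n)) 1+k<n)

crossing : ∀ {π : Permutation′ n} → Unimodal π → ∀ k → 0 < k → k < n → ∃! _≡_ (Crosses π k)
crossing {n = suc _} {π} u =
  interior-induction (λ k → ∃! _≡_ (Crosses π k)) (crossing-base π (fixedPointFree fzero))
    (λ i i>0 1+i<n → crossing-step π i (monotone i i>0 1+i<n))
  where open Unimodal u

-- Unimodal permutations

Within : Permutation′ n → Position n → Set
Within π (i , j) = j ≤ᶠ π ⟨$⟩ʳ i × i ≤ᶠ π ⟨$⟩ˡ j

within? : ∀ (π : Permutation′ n) p → Dec (Within π p)
within? π (i , j) = (j ≤? π ⟨$⟩ʳ i) ×-dec (i ≤? π ⟨$⟩ˡ j)

fullMatrix : Permutation′ n → Matrix n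
fullMatrix π i j = does (within? π (i , j))

module _ {π : Permutation′ n} (u : Unimodal π) where
  open Unimodal u

  -- The crossing r of π at i serves: j < i ≤ π r and r < i ≤ π⁻¹ j make (r , j) admissible.
  full-above : ∀ i j → Within π (i , j) → j <ᶠ i → ∃[ i′ ] i′ <ᶠ i × Within π (i′ , j)
  full-above i j (_ , i≤ρj) j<i
    with r , (r<i , i≤πr) , _ ← crossing u (toℕ i) (ℕ.≤-<-trans z≤n j<i) (toℕ<n i) =
    r , r<i , ℕ.≤-trans (ℕ.<⇒≤ j<i) i≤πr , ℕ.≤-trans (ℕ.<⇒≤ r<i) i≤ρj

  full-¬left : ∀ i j → Within π (i , j) → j <ᶠ i → ¬ (∃[ j′ ] j′ <ᶠ j × Within π (i , j′))
  full-¬left i j (_ , i≤ρj) j<i (j′ , j′<j , _ , i≤ρj′)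
    with _ , _ , uniq ← crossing (Unimodal-flip u) (toℕ i) (ℕ.≤-<-trans z≤n j<i) (toℕ<n i) =
    ℕ.<-irrefl (cong toℕ (trans (sym (uniq (ℕ.<-trans j′<j j<i , i≤ρj′))) (uniq (j<i , i≤ρj)))) j′<j

  -- At an interior i one of π i and π⁻¹ i is below i; at the last i, i ≤ π i would force a fixed
  -- point.
  full-diagonal : ∀ i → Within π (i , i) → toℕ i ≡ 0
  full-diagonal i (i≤πi , i≤ρi) with toℕ i ℕ.≟ 0 | suc (toℕ i) ℕ.<? n
  ... | yes i≡0 | _ = i≡0
  ... | no i≢0 | yes i<n with monotone i (ℕ.n≢0⇒n>0 i≢0) i<n
  ...   | inj₁ (πi<i , _) = contradiction i≤πi (ℕ.<⇒≱ πi<i)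
  ...   | inj₂ (ρi<i , _) = contradiction i≤ρi (ℕ.<⇒≱ ρi<i)
  full-diagonal i (i≤πi , i≤ρi) | no _ | no i≮n =
    contradiction (toℕ-injective (ℕ.≤-antisym
      (ℕ.s≤s⁻¹ (ℕ.≤-trans (toℕ<n (π ⟨$⟩ʳ i)) (ℕ.≮⇒≥ i≮n))) i≤πi)) (fixedPointFree i)

full-exactlyOne : ∀ {π : Permutation′ n} → Unimodal π → ∀ i j → Within π (i , j) → ¬ IsRoot (i , j) →
                  ExactlyOneOf (∃[ i′ ] i′ <ᶠ i × Within π (i′ , j)) (∃[ j′ ] j′ <ᶠ j × Within π (i , j′))
full-exactlyOne {π = π} u i j w ¬r with <-cmp i j
... | tri< i<j _ _ = inj₂
    ( (λ (i′ , i′<i , w′) → full-¬left (Unimodal-flip u) j i (swap w) i<j (i′ , i′<i , swap w′))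
    , map₂ (map₂ swap) (full-above (Unimodal-flip u) j i (swap w) i<j))
... | tri≈ _ refl _ = contradiction (cong suc (full-diagonal u i w) , cong suc (full-diagonal u i w)) ¬r
... | tri> _ _ j<i = inj₁ (full-above u i j w j<i , full-¬left u i j w j<i)

fullMatrix-filling : ∀ {π : Permutation′ (suc n)} → Unimodal π → Filling π (fullMatrix π)
fullMatrix-filling {π = π} u = record
  { root        = (fzero , fzero) , (refl , refl) , into _ _ (z≤n , z≤n)
  ; leaves      = λ i → into _ _ (ℕ.≤-refl , ℕ.≤-reflexive (cong toℕ (sym (inverseˡ π))))
  ; bounded     = outof
  ; unambiguous = λ (i , j) v ¬r → case full-exactlyOne u i j (outof i j v) ¬r of λ where
      (inj₁ ((a , a<i , w) , ¬l)) → inj₁ ((a , a<i , into a j w) ,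
        λ (b , b<j , v) → ¬l (b , b<j , outof i b v))
      (inj₂ (¬a , b , b<j , w)) → inj₂ ((λ (a , a<i , v) → ¬a (a , a<i , outof a j v)) ,
        b , b<j , into i b w)
  }
  where
  into : ∀ i j → Within π (i , j) → Vertex (fullMatrix π) (i , j)
  into i j = dec-true (within? π (i , j))

  outof : ∀ i j → Vertex (fullMatrix π) (i , j) → Within π (i , j)
  outof i j = holds (within? π (i , j))

-- Greedy fillings

-- Since i ≤ π⁻¹ (π i), minimality gives j ≤ π i as well: this is the leftmost admissible position
-- of row i.
RowFirst : Permutation′ n → Fin n → Fin n → Set
RowFirst π i j = i ≤ᶠ π ⟨$⟩ˡ j × (∀ j′ → i ≤ᶠ π ⟨$⟩ˡ j′ → j ≤ᶠ j′)

rowFirst? : ∀ (π : Permutation′ n) i j → Dec (RowFirst π i j)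
rowFirst? π i j = (i ≤? π ⟨$⟩ˡ j) ×-dec all? (λ j′ → (i ≤? π ⟨$⟩ˡ j′) →-dec (j ≤? j′))

-- As j′ < j ≤ π i, the position (i , j′) is admissible too. The available positions are thus the
-- admissible ones that are not leftmost in their row.
Available : Permutation′ n → Fin n → Fin n → Set
Available π i j = Within π (i , j) × ∃[ j′ ] j′ <ᶠ j × i ≤ᶠ π ⟨$⟩ˡ j′

available? : ∀ (π : Permutation′ n) i j → Dec (Available π i j)
available? π i j = within? π (i , j) ×-dec any? (λ j′ → (j′ <? j) ×-dec (i ≤? π ⟨$⟩ˡ j′))

-- c j is the row of the first vertex of column j, for j ≠ 0.  An available leaf has to
-- be chosen: it is not the first in its row, hence would otherwise not be a vertex.
record Choice (π : Permutation′ n) (c : Fin n → Fin n) : Set where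
  field
    available : ∀ j → 0 < toℕ j → Available π (c j) j
    leaf      : ∀ j → Available π (π ⟨$⟩ˡ j) j → c j ≡ π ⟨$⟩ˡ j

Greedy : Permutation′ n → (Fin n → Fin n) → Fin n → Fin n → Set
Greedy π c i j = RowFirst π i j ⊎ (c j ≡ i × Available π i j)

greedy? : ∀ (π : Permutation′ n) c i j → Dec (Greedy π c i j)
greedy? π c i j = rowFirst? π i j ⊎-dec ((c j ≟ i) ×-dec available? π i j)

greedy : Permutation′ n → (Fin n → Fin n) → Matrix n
greedy π c i j = does (greedy? π c i j)

∃-rowFirst : ∀ (π : Permutation′ n) i → ∃ (RowFirst π i)
∃-rowFirst π i = least (λ j → i ≤? π ⟨$⟩ˡ j) (π ⟨$⟩ʳ i , ℕ.≤-reflexive (cong toℕ (sym (inverseˡ π))))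

available⇒leftOf : ∀ (π : Permutation′ n) c i j → Available π i j → ∃ (LeftOf (greedy π c) (i , j))
available⇒leftOf π c i j (_ , j′ , j′<j , i≤ρj′) with b , rf ← ∃-rowFirst π i =
  b , ℕ.≤-<-trans (proj₂ rf j′ i≤ρj′) j′<j , dec-true (greedy? π c i b) (inj₁ rf)

greedy-filling : ∀ {π : Permutation′ (suc n)} {c} → Choice π c → Filling π (greedy π c)
greedy-filling {π = π} {c} ch = record
  { root        = (fzero , fzero) , (refl , refl) , into _ _ (inj₁ (z≤n , λ _ _ → z≤n))
  ; leaves      = λ i → into _ _ (leafᵍ i)
  ; bounded     = λ i j v → within i j (outof i j v)
  ; unambiguous = λ (i , j) v ¬r → exactlyOne i j (outof i j v) ¬r
  }
  where
  open Choice ch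

  into : ∀ i j → Greedy π c i j → Vertex (greedy π c) (i , j)
  into i j = dec-true (greedy? π c i j)

  outof : ∀ i j → Vertex (greedy π c) (i , j) → Greedy π c i j
  outof i j = holds (greedy? π c i j)

  i≤ρπi : ∀ i → i ≤ᶠ π ⟨$⟩ˡ (π ⟨$⟩ʳ i)
  i≤ρπi i = ℕ.≤-reflexive (cong toℕ (sym (inverseˡ π)))

  leafᵍ : ∀ i → Greedy π c i (π ⟨$⟩ʳ i)
  -- An available leaf is chosen by the second condition on c; any other leaf is the first of its
  -- row.
  leafᵍ i with available? π i (π ⟨$⟩ʳ i)
  ... | yes av = inj₂
    (trans (leaf _ (subst (λ x → Available π x (π ⟨$⟩ʳ i)) (sym (inverseˡ π)) av)) (inverseˡ π) , av)
  ... | no ¬av = inj₁ (i≤ρπi i , λ j′ i≤ρj′ →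
    ℕ.≮⇒≥ (λ j′<πi → ¬av ((ℕ.≤-refl , i≤ρπi i) , j′ , j′<πi , i≤ρj′)))

  within : ∀ i j → Greedy π c i j → Within π (i , j)
  within i j (inj₁ (i≤ρj , min)) = min (π ⟨$⟩ʳ i) (i≤ρπi i) , i≤ρj
  within i j (inj₂ (_ , w , _))  = w

  rowFirst⇒above : ∀ i j → RowFirst π i j → 0 < toℕ i → ∃ (Above (greedy π c) (i , j))
  rowFirst⇒above i fzero _ i>0 = fzero , i>0 , into fzero fzero (inj₁ (z≤n , λ _ _ → z≤n))
  -- The column j′ precedes the first one of row i, so c j ≤ π⁻¹ j′ < i and the chosen vertex of
  -- column j lies above.
  rowFirst⇒above i j@(Fin.suc _) (_ , min) _ with av@(_ , j′ , j′<j , cj≤ρj′) ← available j ℕ.z<s =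
    c j , ℕ.≤-<-trans cj≤ρj′ (ℕ.≰⇒> (λ i≤ρj′ → ℕ.<⇒≱ j′<j (min j′ i≤ρj′))) ,
    into (c j) j (inj₂ (refl , av))

  exactlyOne : ∀ i j → Greedy π c i j → ¬ IsRoot (i , j) →
               ExactlyOneOf (∃ (Above (greedy π c) (i , j))) (∃ (LeftOf (greedy π c) (i , j)))
  exactlyOne i j (inj₁ rf@(_ , min)) ¬r =
    inj₁ (rowFirst⇒above i j rf i>0 , λ (j′ , j′<j , v) →
      ℕ.<⇒≱ j′<j (min j′ (proj₂ (within i j′ (outof i j′ v)))))
    where
    i>0 : 0 < toℕ i
    i>0 = ℕ.n≢0⇒n>0 (λ i≡0 → ¬r (cong suc i≡0 ,
      cong suc (ℕ.n≤0⇒n≡0 (min fzero (subst (_≤ _) (sym i≡0) z≤n)))))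
  exactlyOne i j (inj₂ (refl , av@(_ , j′ , j′<j , i≤ρj′))) _ =
    inj₂ ((λ (i′ , i′<i , v) → case outof i′ j v of λ where
        -- The higher row i′ also satisfies i′ ≤ π⁻¹ j′, so j is not its first column.
        (inj₁ (_ , min)) → ℕ.<⇒≱ j′<j (min j′ (ℕ.≤-trans (ℕ.<⇒≤ i′<i) i≤ρj′))
        (inj₂ (refl , _)) → ℕ.<-irrefl refl i′<i)
    , available⇒leftOf π c i j av)

-- Consequences of uniqueness

module _ {π : Permutation′ (suc n)} {M : Matrix (suc n)} (f : Filling π M)
         (unique : ∀ {N} → Filling π N → M ≐ N) where
  open Filling f

  ∃-available : ∀ j → 0 < toℕ j → ∃[ i ] Available π i j
  ∃-available j j>0 with first∈column {M = M} j (_ , leavesᶜ j)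
  ... | i , v , ¬a
    with j′ , j′<j , v′ ← ¬above⇒left {M = M} unambiguous v (<⇒¬rootᶜ {j′ = fzero} j>0) ¬a =
    i , bounded i j v , j′ , j′<j , proj₂ (bounded i j′ v′)

  someChoice : ∃ (Choice π)
  someChoice = proj₁ ∘ pick , record
    { available = proj₁ ∘ proj₂ ∘ pick
    ; leaf      = proj₂ ∘ proj₂ ∘ pick
    }
    where
    pick : ∀ j → ∃[ i ] (0 < toℕ j → Available π i j) × (Available π (π ⟨$⟩ˡ j) j → i ≡ π ⟨$⟩ˡ j)
    pick j with available? π (π ⟨$⟩ˡ j) j | 0 ℕ.<? toℕ j
    ... | yes av | _ = _ , const av , const refl
    ... | no ¬av | yes j>0 with i , av ← ∃-available j j>0 = i , const av , λ av → contradiction av ¬av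
    -- Column 0 has no available position; the value j is a placeholder.
    ... | no ¬av | no j≯0 = j , (λ j>0 → contradiction j>0 j≯0) , λ av → contradiction av ¬av

  -- Any such position is the first of its column in some greedy filling.
  available⇒vertex : ∀ i j → Available π i j → (Available π (π ⟨$⟩ˡ j) j → i ≡ π ⟨$⟩ˡ j) →
                     Vertex M (i , j) × ∃ (LeftOf M (i , j))
  available⇒vertex i j av cond with c , ch ← someChoice =
    trans (M≐N i j) (dec-true (greedy? π c′ i j) (inj₂ (updateAt-updates j c , av))) ,
    map₂ (map₂ (trans (M≐N i _))) (available⇒leftOf π c′ i j av)
    where
    c′ : Fin _ → Fin _
    c′ = updateAt c j (const i)

    ch′ : ∀ k → (0 < toℕ k → Available π (c′ k) k) × (Available π (π ⟨$⟩ˡ k) k → c′ k ≡ π ⟨$⟩ˡ k)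
    ch′ k with k ≟ j
    ... | yes refl rewrite updateAt-updates k {const i} c = const av , cond
    ... | no k≢j rewrite updateAt-minimal k j {const i} c k≢j = Choice.available ch k , Choice.leaf ch k

    M≐N : M ≐ greedy π c′
    M≐N = unique (greedy-filling (record { available = proj₁ ∘ ch′ ; leaf = proj₂ ∘ ch′ }))

module _ {π : Permutation′ (suc n)} {M : Matrix (suc n)} (f : Filling π M)
         (unique : ∀ {N} → Filling π N → M ≐ N) where
  open Filling f

  uniqueᵀ : ∀ {N} → Filling (flip π) N → M ᵀ ≐ N
  uniqueᵀ fN i j = unique (Filling-ᵀ fN) j i

  ¬both-≥ : ∀ k → ∃ (Crosses π (toℕ k)) → ∃ (Crosses (flip π) (toℕ k)) →
            k ≤ᶠ π ⟨$⟩ʳ k → ¬ k ≤ᶠ π ⟨$⟩ˡ k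
  ¬both-≥ k (u , u<k , k≤πu) (e , e<k , k≤ρe) k≤πk k≤ρk with available? π (π ⟨$⟩ˡ k) k
  -- The leaf of column k has a vertex on its left by a greedy filling. As u < k ≤ π⁻¹ k, its
  -- transpose is available too, and a transposed greedy filling puts a vertex above it.
  ... | yes av with v , l ← available⇒vertex f unique (π ⟨$⟩ˡ k) k av (const refl)
                  | _ , a ← available⇒vertex (Filling-ᵀ f) uniqueᵀ k (π ⟨$⟩ˡ k)
                      ((ℕ.≤-refl , ℕ.≤-reflexive (cong toℕ (sym (inverseʳ π)))) ,
                       u , ℕ.<-≤-trans u<k k≤ρk , k≤πu)
                      (const (sym (inverseʳ π))) =
    left⇒¬above {M = M} unambiguous v l a
  -- Column k may now choose row k or row u, both available through e. So (k , k) has a vertex on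
  -- its left, yet (u , k) lies above it.
  ... | no ¬av
    with vk , lk ← available⇒vertex f unique k k ((k≤πk , k≤ρk) , e , e<k , k≤ρe) (λ av → contradiction av ¬av)
       | vu , _ ← available⇒vertex f unique u k
           ((k≤πu , ℕ.≤-trans (ℕ.<⇒≤ u<k) k≤ρk) , e , e<k , ℕ.≤-trans (ℕ.<⇒≤ u<k) k≤ρe)
           (λ av → contradiction av ¬av) =
    left⇒¬above {M = M} unambiguous vk lk (u , u<k , vu)

-- The first vertex (k , j) of row k has some (i , j) above it. If j < k then j crosses under π⁻¹,
-- otherwise i crosses under π.
¬¬crossing : ∀ {π : Permutation′ n} {M} → Filling π M → ∀ k → 0 < k → k < n →
             ¬ ∃ (Crosses π k) → ¬ ¬ ∃ (Crosses (flip π) k)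
¬¬crossing {n = suc _} {π} {M} f k k>0 k<n ¬r ¬c =
  let j , v , ¬l   = first∈row {M = M} κ (_ , leaves κ)
      i , i<κ , v′ = ¬left⇒above {M = M} unambiguous v (<⇒¬rootᵣ {i′ = fzero} κ>0) ¬l
  in case toℕ j ℕ.<? k of λ where
       (yes j<k) → ¬c (j , j<k , subst (_≤ toℕ (π ⟨$⟩ˡ j)) κ≡k (proj₂ (bounded κ j v)))
       (no j≮k)  → ¬r (i , subst (toℕ i <_) κ≡k i<κ ,
         ℕ.≤-trans (ℕ.≮⇒≥ j≮k) (proj₁ (bounded i j v′)))
  where
  open Filling f

  κ : Fin _
  κ = fromℕ< k<n

  κ≡k : toℕ κ ≡ k
  κ≡k = toℕ-fromℕ< k<n

  κ>0 : 0 < toℕ κ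
  κ>0 = subst (0 <_) (sym κ≡k) k>0

Crossed : Permutation′ n → ℕ → Set
Crossed π k = ∃! _≡_ (Crosses π k) × ∃! _≡_ (Crosses (flip π) k)

crossed-step : ∀ (π : Permutation′ n) k → Monotone π k → Crossed π (toℕ k) → Crossed π (suc (toℕ k))
crossed-step π k mono (cr , cc) = crossing-step π k mono cr , crossing-step (flip π) k (Sum.swap mono) cc

module _ {π : Permutation′ (suc n)} {M : Matrix (suc n)} (f : Filling π M)
         (unique : ∀ {N} → Filling π N → M ≐ N) (2≤n : 2 ≤ suc n) where

  fixedPoint⇒⊥ : ∀ k → Crossed π (toℕ k) → π ⟨$⟩ʳ k ≢ k
  fixedPoint⇒⊥ k ((u , cu , _) , (e , ce , _)) πk≡k =
    ¬both-≥ f unique k (u , cu) (e , ce) (ℕ.≤-reflexive (cong toℕ (sym πk≡k)))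
      (ℕ.≤-reflexive (cong toℕ (sym (ʳ⇒ˡ π πk≡k))))

  crossed⇒monotone : ∀ k → suc (toℕ k) < suc n → Crossed π (toℕ k) → Monotone π k
  crossed⇒monotone k 1+k<n cr@(cu@(u , xu , _) , ce@(e , xe , _))
    with π ⟨$⟩ʳ k <? k | π ⟨$⟩ˡ k <? k
  -- Only k could cross at k + 1, under π or π⁻¹, but its image and preimage are both below k. This
  -- contradicts `¬¬crossing`.
  ... | yes πk<k | yes ρk<k = contradiction
    (λ (v , c) → ℕ.<⇒≱ πk<k (subst (λ x → k ≤ᶠ π ⟨$⟩ʳ x) (crossing-absorbed π k cu ρk<k v c) (ℕ.<⇒≤ (proj₂ c))))
    (λ ¬r → ¬¬crossing f (suc (toℕ k)) ℕ.z<s 1+k<n ¬r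
      (λ (v , c) → ℕ.<⇒≱ ρk<k (subst (λ x → k ≤ᶠ π ⟨$⟩ˡ x) (crossing-absorbed (flip π) k ce πk<k v c) (ℕ.<⇒≤ (proj₂ c)))))
  ... | yes πk<k | no ρk≮k = inj₁ (πk<k , ℕ.≤∧≢⇒< (ℕ.≮⇒≥ ρk≮k)
    (λ k≡ρk → fixedPoint⇒⊥ k cr (ʳ⇒ˡ (flip π) (sym (toℕ-injective k≡ρk)))))
  ... | no πk≮k | yes ρk<k = inj₂ (ρk<k , ℕ.≤∧≢⇒< (ℕ.≮⇒≥ πk≮k)
    (λ k≡πk → fixedPoint⇒⊥ k cr (sym (toℕ-injective k≡πk))))
  ... | no πk≮k | no ρk≮k =
    contradiction (ℕ.≮⇒≥ ρk≮k) (¬both-≥ f unique k (u , xu) (e , xe) (ℕ.≮⇒≥ πk≮k))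

  π0≢0 : π ⟨$⟩ʳ fzero ≢ fzero
  π0≢0 π0≡0 = ¬¬crossing f 1 ℕ.z<s 2≤n (stuck π π0≡0) (stuck (flip π) (ʳ⇒ˡ π π0≡0))
    where
    stuck : ∀ (σ : Permutation′ (suc n)) → σ ⟨$⟩ʳ fzero ≡ fzero → ¬ ∃ (Crosses σ 1)
    stuck σ σ0≡0 (fzero , _ , 1≤σ0) = ℕ.n≮0 (subst (λ x → 1 ≤ toℕ x) σ0≡0 1≤σ0)
    stuck σ σ0≡0 (Fin.suc _ , s≤s () , _)

  -- The crossings at i make i monotone, and monotonicity carries them on to i + 1.
  crossed : ∀ k → 0 < k → k < suc n → Crossed π k
  crossed = interior-induction (Crossed π)
    (crossing-base π π0≢0 , crossing-base (flip π) (λ ρ0≡0 → π0≢0 (ʳ⇒ˡ (flip π) ρ0≡0)))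
    (λ i _ 1+i<n cr → crossed-step π i (crossed⇒monotone i 1+i<n cr) cr)

  unique⇒unimodal : Unimodal π
  unique⇒unimodal = record
    { fixedPointFree = λ where
        fzero       → π0≢0
        (Fin.suc i) → fixedPoint⇒⊥ (Fin.suc i) (crossed _ ℕ.z<s (toℕ<n (Fin.suc i)))
    ; monotone       = λ k k>0 1+k<n → crossed⇒monotone k 1+k<n (crossed (toℕ k) k>0 (toℕ<n k))
    }

unimodal⇒unique : ∀ {π : Permutation′ (suc n)} {P} → P ≗ᵖ π → Unimodal π →
                  ∃! _≐_ (λ M → IsCNM M × leafMatrix M ≐ P)
unimodal⇒unique {π = π} P≗π u =
  fullMatrix π , filling⇒CNM P≗π full , λ {M} (cnm , lM≐P) →
    let f = CNM⇒filling P≗π {M} cnm lM≐P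
    in ⊆⇒≐ full f (λ i j v → dec-true (within? π (i , j)) (Filling.bounded f i j v))
  where
  full : Filling π (fullMatrix π)
  full = fullMatrix-filling u

unique⇔unimodal : 2 ≤ n → ∀ {π : Permutation′ n} {P} → P ≗ᵖ π →
                  ∃! _≐_ (λ M → IsCNM M × leafMatrix M ≐ P) ⇔ Unimodal π
unique⇔unimodal {n = suc _} 2≤n P≗π = mk⇔
  (λ (M , (cnm , lM≐P) , unique) →
    unique⇒unimodal (CNM⇒filling P≗π {M} cnm lM≐P) (λ {N} f → unique (filling⇒CNM P≗π {N} f)) 2≤n)
  (unimodal⇒unique P≗π)

-- L-subsets

OneInEachL : Matrix n → Set
OneInEachL {n} P = ∀ k → 2 ≤ k → k ≤ n ∸ 1 → ∃! _≡_ (λ (p : Position n) → LSubset k p × Vertex P p)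

module _ {π : Permutation′ n} {P : Matrix n} (P≗π : P ≗ᵖ π) where

  vertexʳ : ∀ i → Vertex P (i , π ⟨$⟩ʳ i)
  vertexʳ i = Equivalence.from (P≗π _ _) refl

  vertexˡ : ∀ j → Vertex P (π ⟨$⟩ˡ j , j)
  vertexˡ j = Equivalence.from (P≗π _ _) (inverseʳ π)

  -- The only possible ones in this L-subset are (k , π k), when π k ≤ k, and (π⁻¹ k , k), when π⁻¹
  -- k ≤ k. Off the diagonal they differ, so exactly one of the two inequalities holds.
  L⇒monotone : ∀ k → π ⟨$⟩ʳ k ≢ k → ∃! _≡_ (λ (p : Position n) → LSubset (index k) p × Vertex P p) →
               Monotone π k
  L⇒monotone k πk≢k (p , (l , v) , uniq) with ℕ.<-cmp (toℕ (π ⟨$⟩ʳ k)) (toℕ k) | ℕ.<-cmp (toℕ (π ⟨$⟩ˡ k)) (toℕ k)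
  ... | tri≈ _ πk≡k _ | _ = contradiction (toℕ-injective πk≡k) πk≢k
  ... | _ | tri≈ _ ρk≡k _ = contradiction (ʳ⇒ˡ (flip π) (toℕ-injective ρk≡k)) πk≢k
  ... | tri< πk<k _ _ | tri> _ _ k<ρk = inj₁ (πk<k , k<ρk)
  ... | tri> _ _ k<πk | tri< ρk<k _ _ = inj₂ (ρk<k , k<πk)
  ... | tri< πk<k _ _ | tri< ρk<k _ _ = contradiction
    (cong proj₂ (trans (sym (uniq (inj₁ (refl , ℕ.<⇒≤ (s≤s πk<k)) , vertexʳ k)))
                       (uniq (inj₂ (refl , ℕ.<⇒≤ (s≤s ρk<k)) , vertexˡ k)))) πk≢k
  ... | tri> _ _ k<πk | tri> _ _ k<ρk with l | Equivalence.to (P≗π _ _) v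
  ...   | inj₁ (i≡k , j≤k) | refl with refl ← toℕ-injective (ℕ.suc-injective i≡k) =
    contradiction (ℕ.s≤s⁻¹ j≤k) (ℕ.<⇒≱ k<πk)
  ...   | inj₂ (j≡k , i≤k) | πi≡j with refl ← toℕ-injective (ℕ.suc-injective j≡k) =
    contradiction (ℕ.s≤s⁻¹ i≤k) (ℕ.<⇒≱ (subst (k <ᶠ_) (ʳ⇒ˡ π πi≡j) k<ρk))

  monotone⇒L : ∀ k → Monotone π k → ∃! _≡_ (λ (p : Position n) → LSubset (index k) p × Vertex P p)
  monotone⇒L k (inj₁ (πk<k , k<ρk)) =
    _ , (inj₁ (refl , ℕ.<⇒≤ (s≤s πk<k)) , vertexʳ k) , λ {(i , j)} (l , v) → unique i j l (Equivalence.to (P≗π i j) v)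
    where
    unique : ∀ i j → LSubset (index k) (i , j) → π ⟨$⟩ʳ i ≡ j → (k , π ⟨$⟩ʳ k) ≡ (i , j)
    unique i j (inj₁ (i≡k , _)) refl with refl ← toℕ-injective (ℕ.suc-injective i≡k) = refl
    unique i j (inj₂ (j≡k , i≤k)) πi≡j with refl ← toℕ-injective (ℕ.suc-injective j≡k) =
      contradiction (ℕ.s≤s⁻¹ i≤k) (ℕ.<⇒≱ (subst (k <ᶠ_) (ʳ⇒ˡ π πi≡j) k<ρk))
  monotone⇒L k (inj₂ (ρk<k , k<πk)) =
    _ , (inj₂ (refl , ℕ.<⇒≤ (s≤s ρk<k)) , vertexˡ k) , λ {(i , j)} (l , v) → unique i j l (Equivalence.to (P≗π i j) v)
    where
    unique : ∀ i j → LSubset (index k) (i , j) → π ⟨$⟩ʳ i ≡ j → (π ⟨$⟩ˡ k , k) ≡ (i , j)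
    unique i j (inj₁ (i≡k , j≤k)) refl with refl ← toℕ-injective (ℕ.suc-injective i≡k) =
      contradiction (ℕ.s≤s⁻¹ j≤k) (ℕ.<⇒≱ k<πk)
    unique i j (inj₂ (j≡k , _)) πi≡j with refl ← toℕ-injective (ℕ.suc-injective j≡k) =
      cong (_, k) (ʳ⇒ˡ π πi≡j)

unimodal⇔L : ∀ {π : Permutation′ n} {P} → P ≗ᵖ π → Unimodal π ⇔ (OneInEachL P × (∀ i → P i i ≡ false))
unimodal⇔L {n = zero} P≗π = mk⇔
  (λ _ → (λ k 2≤k k≤0 → contradiction (ℕ.≤-trans 2≤k k≤0) λ ()) , λ ())
  (λ _ → record { fixedPointFree = λ () ; monotone = λ () })
unimodal⇔L {n = suc n} {π} {P} P≗π = mk⇔ to from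
  where
  to : Unimodal π → OneInEachL P × (∀ i → P i i ≡ false)
  to u = oneInEachL , λ i → ¬-not (fixedPointFree i ∘ Equivalence.to (P≗π i i))
    where
    open Unimodal u

    oneInEachL : OneInEachL P
    -- The index `suc k` belongs to the element k of `Fin`; its bounds exclude the first and the
    -- last element.
    oneInEachL (suc k) (s≤s k>0) k<n =
      subst (λ x → ∃! _≡_ (λ p → LSubset (suc x) p × Vertex P p)) κ≡k
        (monotone⇒L {π = π} P≗π κ (monotone κ (subst (0 <_) (sym κ≡k) k>0)
          (subst (λ x → suc x < suc n) (sym κ≡k) (s≤s k<n))))
      where
      k<1+n : k < suc n
      k<1+n = ℕ.m<n⇒m<1+n k<n

      κ : Fin (suc n)
      κ = fromℕ< k<1+n

      κ≡k : toℕ κ ≡ k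
      κ≡k = toℕ-fromℕ< k<1+n

  from : OneInEachL P × (∀ i → P i i ≡ false) → Unimodal π
  from (one , offDiagonal) = record
    { fixedPointFree = fpf
    ; monotone       = λ k k>0 1+k<n →
        L⇒monotone {π = π} P≗π k (fpf k) (one (index k) (s≤s k>0) (ℕ.s≤s⁻¹ 1+k<n))
    }
    where
    fpf : ∀ i → π ⟨$⟩ʳ i ≢ i
    fpf i πi≡i with () ← trans (sym (Equivalence.from (P≗π i i) πi≡i)) (offDiagonal i)

-- Permutation matrices

toPermutation : ∀ {P : Matrix n} → IsPermutationMatrix P → ∃ (P ≗ᵖ_)
toPermutation {n} {P} perm = π , λ i j → mk⇔
    (proj₂ (proj₂ (row i)))
    (λ { refl → proj₁ (proj₂ (row i)) })
  where
  open IsPermutationMatrix perm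

  π : Permutation′ n
  π = permutation (proj₁ ∘ row) (proj₁ ∘ column)
    (λ j → proj₂ (proj₂ (row _)) (proj₁ (proj₂ (column j))))
    (λ i → proj₂ (proj₂ (column _)) (proj₁ (proj₂ (row i))))

theorem3p4 : ∀ (n : ℕ) → 2 ≤ n → (P : Matrix n) → IsPermutationMatrix P →
    ∃! _≐_ (λ M → IsCNM M × leafMatrix M ≐ P)
    ⇔
    ((∀ (k : ℕ) → 2 ≤ k → k ≤ n ∸ 1 → ∃! _≡_ (λ (p : Position n) → LSubset k p × Vertex P p))
    × (∀ i → P i i ≡ false))
theorem3p4 n 2≤n P perm with π , P≗π ← toPermutation perm =
  unimodal⇔L {π = π} P≗π ⇔-∘ unique⇔unimodal 2≤n {π} P≗π
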